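{- Let $0<\delta<\frac12$ be a constant. Let $g(n_1)$ be a sequence of positive reals indexed by $n_1$ with $g(n_1)=\omega(1)$ and $g(n_1)=o(\sqrt{n_1})$, and define $k_1(n_1)=g(n_1)\sqrt{n_1}$. Suppose that any family of algorithms $\{\mathcal A_{n_1}\}$ that attempts to solve $\mathsf{iidPC_D}\!\left(n_1,\frac{k_1(n_1)}{n_1}\right)$ in time $T_1(n_1)=O\!\left(n_1^{1+\delta}\right)$ has probability of success at most $\frac12+o(1)$. Let $k_2(n_2)=g(n_2^2)$. Then any family of algorithms $\{\mathcal A_{n_2}\}$ that attempts to solve $\mathsf{iidPC_D}\!\left(n_2,\frac{k_2(n_2)}{n_2}\right)$ in time $T_2(n_2)=O\!\left(n_2^{2+2\delta}\right)$ has probability of success at most $\frac12+o(1)$.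
   Context: $G(n,\frac12)$ is the Erdős–Rényi random graph on $n$ vertices. $\hat G(n,\frac12,p)$: each vertex of a vertex set $V$ of size $n$ is included in a set $K$ independently with probability $p$; all pairs of distinct vertices of $K$ are edges, and every other pair of distinct vertices is an edge independently with probability $\frac12$. $\mathsf{iidPC_D}(n,p)$ is the hypothesis testing problem of deciding between $H_0:G\sim G(n,\frac12)$ and $H_1:G\sim\hat G(n,\frac12,p)$. The probability of success of a (possibly randomized) algorithm $\mathcal A$ with output in $\{0,1\}$ is $\frac12\left(\mathbb P_{H_0}(\mathcal A=0)+\mathbb P_{H_1}(\mathcal A=1)\right)$. Model of computation: an algorithm family $\{\mathcal A_n\}$ consists of one (randomized) algorithm for each $n$; the graph is accessed through its adjacency matrix; querying any entry takes unit time, sampling a uniformly random vertex takes unit time, and similar elementary vertex/edge operations take unit time. -}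

module Defs where

open import Data.Bool.Base using (Bool; true; false; if_then_else_; not; _∧_; _∨_)
open import Data.Fin.Base as Fin using (Fin; toℕ; fromℕ<)
open import Data.Fin.Properties using (<-cmp)
open import Data.Integer.Base using (+_)
import Data.Integer.Base as ℤ
import Data.Integer.Properties as ℤ
open import Data.List.Base using (List; []; _∷_; map; concatMap; allFin; length; head; drop)
open import Data.List.Relation.Unary.All using (All)
open import Data.Maybe.Base using (Maybe; just; nothing)
open import Data.Nat.Base as ℕ using (ℕ; zero; suc; NonZero; _^_)
import Data.Nat.DivMod as ℕ
import Data.Nat.Properties as ℕ
import Data.Nat.Tactic.RingSolver as ℕ-Ring
open import Data.Product.Base using (∃-syntax; _×_; _,_; proj₁)
open import Data.Rational.Base as ℚ using (ℚ; mkℚ; 0ℚ; 1ℚ; ½; ∣_∣; _/_)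
import Data.Rational.Properties as ℚ
import Data.Rational.Unnormalised.Base as ℚᵘ
import Data.Rational.Unnormalised.Properties as ℚᵘ
open import Data.Rational.Solver using (module +-*-Solver)
open import Data.Sum.Base using (_⊎_; inj₁; inj₂)
open import Data.Vec.Base as Vec using (Vec; []; _∷_)
open import Relation.Binary.Definitions using (tri<; tri≈; tri>)
open import Relation.Binary.PropositionalEquality
open import Relation.Nullary using (yes; no; contradiction)
open import Relation.Nullary.Decidable using (does)

Cauchy : (ℕ → ℚ) → Set
Cauchy x = ∀ ε → 0ℚ ℚ.< ε →
  ∃[ N ] (∀ m n → N ℕ.≤ m → N ℕ.≤ n → ∣ x m ℚ.- x n ∣ ℚ.≤ ε)

record ℝ : Set where
  constructor mkℝ
  field
    seq    : ℕ → ℚ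
    cauchy : Cauchy seq

open ℝ public

private
  0<½ε : ∀ ε → 0ℚ ℚ.< ε → 0ℚ ℚ.< ½ ℚ.* ε
  0<½ε ε 0<ε = ℚ.positive⁻¹ (½ ℚ.* ε)
    {{ℚ.pos*pos⇒pos ½ ε {{ℚ.positive 0<ε}}}}

  halves : ∀ ε → ½ ℚ.* ε ℚ.+ ½ ℚ.* ε ≡ ε
  halves ε = trans (sym (ℚ.*-distribʳ-+ ε ½ ½)) (ℚ.*-identityˡ ε)

  const-cauchy : ∀ q → Cauchy (λ _ → q)
  const-cauchy q ε 0<ε = 0 , λ _ _ _ _ →
    subst (λ z → ∣ z ∣ ℚ.≤ ε) (sym (ℚ.+-inverseʳ q)) (ℚ.<⇒≤ 0<ε)

  +-cauchy : ∀ {x y} → Cauchy x → Cauchy y → Cauchy (λ n → x n ℚ.+ y n)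
  +-cauchy {x} {y} cx cy ε 0<ε
    with cx (½ ℚ.* ε) (0<½ε ε 0<ε) | cy (½ ℚ.* ε) (0<½ε ε 0<ε)
  ... | M , hx | N , hy = M ℕ.⊔ N , λ m n p q → begin
      ∣ (x m ℚ.+ y m) ℚ.- (x n ℚ.+ y n) ∣
        ≡⟨ cong ∣_∣ (rearrange (x m) (y m) (x n) (y n)) ⟩
      ∣ (x m ℚ.- x n) ℚ.+ (y m ℚ.- y n) ∣
        ≤⟨ ℚ.∣p+q∣≤∣p∣+∣q∣ (x m ℚ.- x n) (y m ℚ.- y n) ⟩
      ∣ x m ℚ.- x n ∣ ℚ.+ ∣ y m ℚ.- y n ∣
        ≤⟨ ℚ.+-mono-≤
             (hx m n (ℕ.m⊔n≤o⇒m≤o M N p) (ℕ.m⊔n≤o⇒m≤o M N q))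
             (hy m n (ℕ.m⊔n≤o⇒n≤o M N p) (ℕ.m⊔n≤o⇒n≤o M N q)) ⟩
      ½ ℚ.* ε ℚ.+ ½ ℚ.* ε
        ≡⟨ halves ε ⟩
      ε ∎
    where
    open ℚ.≤-Reasoning
    rearrange : ∀ a b c d → (a ℚ.+ b) ℚ.- (c ℚ.+ d) ≡ (a ℚ.- c) ℚ.+ (b ℚ.- d)
    rearrange = solve 4 (λ a b c d →
      (a :+ b) :- (c :+ d) := (a :- c) :+ (b :- d)) refl
      where open +-*-Solver

  neg-cauchy : ∀ {x} → Cauchy x → Cauchy (λ n → ℚ.- x n)
  neg-cauchy {x} cx ε 0<ε with cx ε 0<ε
  ... | N , hx = N , λ m n p q → begin
      ∣ ℚ.- x m ℚ.- (ℚ.- x n) ∣  ≡⟨ cong ∣_∣ (rearrange (x m) (x n)) ⟩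
      ∣ x n ℚ.- x m ∣            ≤⟨ hx n m q p ⟩
      ε                          ∎
    where
    open ℚ.≤-Reasoning
    rearrange : ∀ a b → ℚ.- a ℚ.- (ℚ.- b) ≡ b ℚ.- a
    rearrange = solve 2 (λ a b → :- a :- (:- b) := b :- a) refl
      where open +-*-Solver

  Bounded : (ℕ → ℚ) → Set
  Bounded x = ∃[ B ] ∃[ N ] (0ℚ ℚ.< B × (∀ n → N ℕ.≤ n → ∣ x n ∣ ℚ.≤ B))

  eventually-bounded : ∀ {x} → Cauchy x → Bounded x
  eventually-bounded {x} cx with cx 1ℚ (ℚ.positive⁻¹ 1ℚ)
  ... | N , hx = 1ℚ ℚ.+ ∣ x N ∣ , N
      , ℚ.positive⁻¹ _ {{ℚ.pos+nonNeg⇒pos 1ℚ ∣ x N ∣ {{ℚ.nonNegative (ℚ.0≤∣p∣ (x N))}}}}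
      , λ n p → begin
      ∣ x n ∣                     ≡⟨ cong ∣_∣ (rearrange (x n) (x N)) ⟩
      ∣ (x n ℚ.- x N) ℚ.+ x N ∣   ≤⟨ ℚ.∣p+q∣≤∣p∣+∣q∣ (x n ℚ.- x N) (x N) ⟩
      ∣ x n ℚ.- x N ∣ ℚ.+ ∣ x N ∣ ≤⟨ ℚ.+-monoˡ-≤ ∣ x N ∣ (hx n N p ℕ.≤-refl) ⟩
      1ℚ ℚ.+ ∣ x N ∣              ∎
    where
    open ℚ.≤-Reasoning
    rearrange : ∀ a b → a ≡ (a ℚ.- b) ℚ.+ b
    rearrange = solve 2 (λ a b → a := (a :- b) :+ b) refl
      where open +-*-Solver

  *-mono : ∀ {a b c d} → 0ℚ ℚ.≤ b → 0ℚ ℚ.≤ c → a ℚ.≤ c → b ℚ.≤ d → a ℚ.* b ℚ.≤ c ℚ.* d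
  *-mono {a} {b} {c} {d} 0≤b 0≤c a≤c b≤d = ℚ.≤-trans
    (ℚ.*-monoʳ-≤-nonNeg b {{ℚ.nonNegative 0≤b}} a≤c)
    (ℚ.*-monoˡ-≤-nonNeg c {{ℚ.nonNegative 0≤c}} b≤d)

  *-estimate : ∀ A B η a b c d → 0ℚ ℚ.< A → 0ℚ ℚ.< B →
    ∣ a ∣ ℚ.≤ A → ∣ d ∣ ℚ.≤ B → ∣ a ℚ.- c ∣ ℚ.≤ η → ∣ b ℚ.- d ∣ ℚ.≤ η →
    ∣ a ℚ.* b ℚ.- c ℚ.* d ∣ ℚ.≤ (A ℚ.+ B) ℚ.* η
  *-estimate A B η a b c d 0<A 0<B a≤A d≤B ac bd = begin
      ∣ a ℚ.* b ℚ.- c ℚ.* d ∣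
        ≡⟨ cong ∣_∣ (split a b c d) ⟩
      ∣ a ℚ.* (b ℚ.- d) ℚ.+ d ℚ.* (a ℚ.- c) ∣
        ≤⟨ ℚ.∣p+q∣≤∣p∣+∣q∣ (a ℚ.* (b ℚ.- d)) (d ℚ.* (a ℚ.- c)) ⟩
      ∣ a ℚ.* (b ℚ.- d) ∣ ℚ.+ ∣ d ℚ.* (a ℚ.- c) ∣
        ≡⟨ cong₂ ℚ._+_ (ℚ.∣p*q∣≡∣p∣*∣q∣ a (b ℚ.- d)) (ℚ.∣p*q∣≡∣p∣*∣q∣ d (a ℚ.- c)) ⟩
      ∣ a ∣ ℚ.* ∣ b ℚ.- d ∣ ℚ.+ ∣ d ∣ ℚ.* ∣ a ℚ.- c ∣
        ≤⟨ ℚ.+-mono-≤ (*-mono (ℚ.0≤∣p∣ (b ℚ.- d)) (ℚ.<⇒≤ 0<A) a≤A bd)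
                      (*-mono (ℚ.0≤∣p∣ (a ℚ.- c)) (ℚ.<⇒≤ 0<B) d≤B ac) ⟩
      A ℚ.* η ℚ.+ B ℚ.* η
        ≡⟨ ℚ.*-distribʳ-+ η A B ⟨
      (A ℚ.+ B) ℚ.* η ∎
    where
    open ℚ.≤-Reasoning
    split : ∀ a b c d → a ℚ.* b ℚ.- c ℚ.* d ≡ a ℚ.* (b ℚ.- d) ℚ.+ d ℚ.* (a ℚ.- c)
    split = solve 4 (λ a b c d →
      a :* b :- c :* d := a :* (b :- d) :+ d :* (a :- c)) refl
      where open +-*-Solver

  quotient : ∀ D ε → 0ℚ ℚ.< D → 0ℚ ℚ.< ε → ∃[ η ] (0ℚ ℚ.< η × D ℚ.* η ≡ ε)
  quotient D ε 0<D 0<ε = ℚ.1/ D ℚ.* ε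
    , ℚ.positive⁻¹ (ℚ.1/ D ℚ.* ε) {{ℚ.pos*pos⇒pos (ℚ.1/ D) {{ℚ.1/pos⇒pos D}} ε {{ℚ.positive 0<ε}}}}
    , trans (sym (ℚ.*-assoc D (ℚ.1/ D) ε))
        (trans (cong (ℚ._* ε) (ℚ.*-inverseʳ D)) (ℚ.*-identityˡ ε))
    where
    instance
      D-positive : ℚ.Positive D
      D-positive = ℚ.positive 0<D
      D-nonZero : ℚ.NonZero D
      D-nonZero = ℚ.pos⇒nonZero D

  *-cauchy-bounded : ∀ {x y} → Bounded x → Bounded y → Cauchy x → Cauchy y →
    Cauchy (λ n → x n ℚ.* y n)
  *-cauchy-bounded {x} {y} (A , K , 0<A , bx) (B , L , 0<B , by) cx cy ε 0<ε =
    let η , 0<η , Dη≡ε = quotient (A ℚ.+ B) ε (ℚ.+-mono-< 0<A 0<B) 0<ε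
    in bound η Dη≡ε (cx η 0<η) (cy η 0<η)
    where
    Within : (ℕ → ℚ) → ℚ → Set
    Within z η = ∃[ N ] (∀ m n → N ℕ.≤ m → N ℕ.≤ n → ∣ z m ℚ.- z n ∣ ℚ.≤ η)
    bound : ∀ η → (A ℚ.+ B) ℚ.* η ≡ ε → Within x η → Within y η →
      Within (λ n → x n ℚ.* y n) ε
    bound η Dη≡ε (M , hx) (N , hy) = (K ℕ.⊔ L) ℕ.⊔ (M ℕ.⊔ N) , λ m n p q →
      let KL≤p = ℕ.m⊔n≤o⇒m≤o (K ℕ.⊔ L) (M ℕ.⊔ N) p
          KL≤q = ℕ.m⊔n≤o⇒m≤o (K ℕ.⊔ L) (M ℕ.⊔ N) q
          MN≤p = ℕ.m⊔n≤o⇒n≤o (K ℕ.⊔ L) (M ℕ.⊔ N) p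
          MN≤q = ℕ.m⊔n≤o⇒n≤o (K ℕ.⊔ L) (M ℕ.⊔ N) q
      in subst (∣ x m ℚ.* y m ℚ.- x n ℚ.* y n ∣ ℚ.≤_) Dη≡ε
           (*-estimate A B η (x m) (y m) (x n) (y n) 0<A 0<B
             (bx m (ℕ.m⊔n≤o⇒m≤o K L KL≤p))
             (by n (ℕ.m⊔n≤o⇒n≤o K L KL≤q))
             (hx m n (ℕ.m⊔n≤o⇒m≤o M N MN≤p) (ℕ.m⊔n≤o⇒m≤o M N MN≤q))
             (hy m n (ℕ.m⊔n≤o⇒n≤o M N MN≤p) (ℕ.m⊔n≤o⇒n≤o M N MN≤q)))

  *-cauchy : ∀ {x y} → Cauchy x → Cauchy y → Cauchy (λ n → x n ℚ.* y n)
  *-cauchy {x} {y} cx cy = *-cauchy-bounded {x} {y}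
    (eventually-bounded {x} cx) (eventually-bounded {y} cy) cx cy

fromℚ : ℚ → ℝ
fromℚ q = mkℝ (λ _ → q) (const-cauchy q)

fromℕ : ℕ → ℝ
fromℕ n = fromℚ (+ n / 1)

0ᴿ 1ᴿ ½ᴿ : ℝ
0ᴿ = fromℚ 0ℚ
1ᴿ = fromℚ 1ℚ
½ᴿ = fromℚ ½

infixl 6 _+ᴿ_ _-ᴿ_
infixl 7 _*ᴿ_ _/ᴿ_
infix  4 _≤ᴿ_ _<ᴿ_

_+ᴿ_ : ℝ → ℝ → ℝ
x +ᴿ y = mkℝ (λ n → seq x n ℚ.+ seq y n) (+-cauchy {seq x} {seq y} (cauchy x) (cauchy y))

-ᴿ_ : ℝ → ℝ
-ᴿ x = mkℝ (λ n → ℚ.- seq x n) (neg-cauchy {seq x} (cauchy x))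

_-ᴿ_ : ℝ → ℝ → ℝ
x -ᴿ y = x +ᴿ (-ᴿ y)

_*ᴿ_ : ℝ → ℝ → ℝ
x *ᴿ y = mkℝ (λ n → seq x n ℚ.* seq y n) (*-cauchy {seq x} {seq y} (cauchy x) (cauchy y))

_/ᴿ_ : ℝ → (n : ℕ) → .{{NonZero n}} → ℝ
x /ᴿ n = x *ᴿ fromℚ (+ 1 / n)

_≤ᴿ_ : ℝ → ℝ → Set
x ≤ᴿ y = ∀ ε → 0ℚ ℚ.< ε →
  ∃[ N ] (∀ n → N ℕ.≤ n → seq x n ℚ.≤ seq y n ℚ.+ ε)

_<ᴿ_ : ℝ → ℝ → Set
x <ᴿ y = ∃[ ε ] (0ℚ ℚ.< ε × x +ᴿ fromℚ ε ≤ᴿ y)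

isqrt : ℕ → ℕ
isqrt zero    = zero
isqrt (suc m) with suc (isqrt m) ℕ.* suc (isqrt m) ℕ.≤? suc m
... | yes _ = suc (isqrt m)
... | no  _ = isqrt m

isqrt-spec : ∀ m → (isqrt m ℕ.* isqrt m ℕ.≤ m) × (m ℕ.< suc (isqrt m) ℕ.* suc (isqrt m))
isqrt-spec zero = ℕ.z≤n , ℕ.s≤s ℕ.z≤n
isqrt-spec (suc m) with isqrt-spec m | suc (isqrt m) ℕ.* suc (isqrt m) ℕ.≤? suc m
... | _  , hi | yes p = p , ℕ.≤-trans (ℕ.s≤s hi)
                              (ℕ.*-mono-< (ℕ.n<1+n (suc (isqrt m))) (ℕ.n<1+n (suc (isqrt m))))
... | lo , _  | no ¬p = ℕ.m≤n⇒m≤1+n lo , ℕ.≰⇒> ¬p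

√-seq : ℕ → ℕ → ℚ
√-seq n k = + isqrt (n ℕ.* (suc k ℕ.* suc k)) / suc k

square-cancel-< : ∀ a b → a ℕ.* a ℕ.< b ℕ.* b → a ℕ.< b
square-cancel-< a b aa<bb with ℕ.<-≤-connex a b
... | inj₁ a<b = a<b
... | inj₂ b≤a = contradiction (ℕ.*-mono-≤ b≤a b≤a) (ℕ.<⇒≱ aa<bb)

isqrt-cross : ∀ n k l →
  isqrt (n ℕ.* (suc k ℕ.* suc k)) ℕ.* suc l ℕ.≤
  suc (isqrt (n ℕ.* (suc l ℕ.* suc l))) ℕ.* suc k
isqrt-cross n k l
  with isqrt (n ℕ.* (suc k ℕ.* suc k)) | isqrt-spec (n ℕ.* (suc k ℕ.* suc k))
     | isqrt (n ℕ.* (suc l ℕ.* suc l)) | isqrt-spec (n ℕ.* (suc l ℕ.* suc l))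
... | a | a²≤ , _ | b | _ , <b² = ℕ.<⇒≤ (square-cancel-< _ _ (begin-strict
    (a ℕ.* suc l) ℕ.* (a ℕ.* suc l)              ≡⟨ interchange a (suc l) ⟩
    (a ℕ.* a) ℕ.* (suc l ℕ.* suc l)              ≤⟨ ℕ.*-monoˡ-≤ (suc l ℕ.* suc l) a²≤ ⟩
    n ℕ.* (suc k ℕ.* suc k) ℕ.* (suc l ℕ.* suc l) ≡⟨ swap n (suc k ℕ.* suc k) (suc l ℕ.* suc l) ⟩
    n ℕ.* (suc l ℕ.* suc l) ℕ.* (suc k ℕ.* suc k) <⟨ ℕ.*-monoˡ-< (suc k ℕ.* suc k) <b² ⟩
    (suc b ℕ.* suc b) ℕ.* (suc k ℕ.* suc k)      ≡⟨ interchange (suc b) (suc k) ⟨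
    (suc b ℕ.* suc k) ℕ.* (suc b ℕ.* suc k)      ∎))
  where
  open ℕ.≤-Reasoning
  interchange : ∀ x y → (x ℕ.* y) ℕ.* (x ℕ.* y) ≡ (x ℕ.* x) ℕ.* (y ℕ.* y)
  interchange = ℕ-Ring.solve-∀
  swap : ∀ x y z → x ℕ.* y ℕ.* z ≡ x ℕ.* z ℕ.* y
  swap = ℕ-Ring.solve-∀

/-mono : ∀ a b c d .{{_ : NonZero b}} .{{_ : NonZero d}} →
  a ℕ.* d ℕ.≤ c ℕ.* b → + a / b ℚ.≤ + c / d
/-mono a b@(suc _) c d@(suc _) le = ℚ.toℚᵘ-cancel-≤ (begin
    ℚ.toℚᵘ (+ a / b)   ≃⟨ ℚ.toℚᵘ-fromℚᵘ (+ a ℚᵘ./ b) ⟩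
    + a ℚᵘ./ b         ≤⟨ ℚᵘ.*≤* (subst₂ ℤ._≤_ (ℤ.pos-* a d) (ℤ.pos-* c b) (ℤ.+≤+ le)) ⟩
    + c ℚᵘ./ d         ≃⟨ ℚ.toℚᵘ-fromℚᵘ (+ c ℚᵘ./ d) ⟨
    ℚ.toℚᵘ (+ c / d)   ∎)
  where open ℚᵘ.≤-Reasoning

/-suc : ∀ a b .{{_ : NonZero b}} → + suc a / b ≡ + a / b ℚ.+ + 1 / b
/-suc a b@(suc _) = ℚ.toℚᵘ-injective (begin
    ℚ.toℚᵘ (+ suc a / b)               ≈⟨ ℚ.toℚᵘ-fromℚᵘ (+ suc a ℚᵘ./ b) ⟩
    + suc a ℚᵘ./ b                     ≈⟨ ℚᵘ.*≡* numer ⟩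
    + a ℚᵘ./ b ℚᵘ.+ + 1 ℚᵘ./ b         ≈⟨ ℚᵘ.+-cong (ℚ.toℚᵘ-fromℚᵘ (+ a ℚᵘ./ b)) (ℚ.toℚᵘ-fromℚᵘ (+ 1 ℚᵘ./ b)) ⟨
    ℚ.toℚᵘ (+ a / b) ℚᵘ.+ ℚ.toℚᵘ (+ 1 / b) ≈⟨ ℚ.toℚᵘ-homo-+ (+ a / b) (+ 1 / b) ⟨
    ℚ.toℚᵘ (+ a / b ℚ.+ + 1 / b)       ∎)
  where
  open ℚᵘ.≃-Reasoning
  nat : suc a ℕ.* (b ℕ.* b) ≡ (a ℕ.* b ℕ.+ 1 ℕ.* b) ℕ.* b
  nat = lemma a b
    where
    lemma : ∀ a b → suc a ℕ.* (b ℕ.* b) ≡ (a ℕ.* b ℕ.+ 1 ℕ.* b) ℕ.* b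
    lemma = ℕ-Ring.solve-∀
  numer : + suc a ℤ.* (+ (b ℕ.* b)) ≡ (+ a ℤ.* + b ℤ.+ + 1 ℤ.* + b) ℤ.* + b
  numer rewrite sym (ℤ.pos-* (suc a) (b ℕ.* b)) | sym (ℤ.pos-* a b) | sym (ℤ.pos-* 1 b)
              | sym (ℤ.pos-* (a ℕ.* b ℕ.+ 1 ℕ.* b) b) = cong +_ nat

reciprocal-below : ∀ ε → 0ℚ ℚ.< ε → ∃[ N ] (+ 1 / suc N ℚ.≤ ε)
reciprocal-below ε 0<ε with ε | ℚ.positive 0<ε
... | mkℚ (+ suc p) d c | _ = d , subst (+ 1 / suc d ℚ.≤_) (ℚ.↥p/↧p≡p (mkℚ (+ suc p) d c))
  (/-mono 1 (suc d) (suc p) (suc d) (ℕ.*-monoˡ-≤ (suc d) {1} {suc p} (ℕ.s≤s ℕ.z≤n)))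

√-step : ∀ n k l → √-seq n k ℚ.≤ √-seq n l ℚ.+ + 1 / suc l
√-step n k l = ℚ.≤-trans
  (/-mono (isqrt (n ℕ.* (suc k ℕ.* suc k))) (suc k)
            (suc (isqrt (n ℕ.* (suc l ℕ.* suc l)))) (suc l) (isqrt-cross n k l))
  (ℚ.≤-reflexive (/-suc (isqrt (n ℕ.* (suc l ℕ.* suc l))) (suc l)))

≤-shift : ∀ a b c → a ℚ.≤ b ℚ.+ c → a ℚ.- b ℚ.≤ c
≤-shift a b c le = subst (a ℚ.- b ℚ.≤_) (lemma b c) (ℚ.+-monoˡ-≤ (ℚ.- b) le)
  where
  lemma : ∀ b c → b ℚ.+ c ℚ.- b ≡ c
  lemma = solve 2 (λ b c → b :+ c :- b := c) refl
    where open +-*-Solver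

√-cauchy : ∀ n → Cauchy (√-seq n)
√-cauchy n ε 0<ε with reciprocal-below ε 0<ε
... | N , 1/N≤ε = N , bound
  where
  one-sided : ∀ k l → N ℕ.≤ l → √-seq n k ℚ.- √-seq n l ℚ.≤ ε
  one-sided k l N≤l = ≤-shift (√-seq n k) (√-seq n l) ε (ℚ.≤-trans (√-step n k l)
    (ℚ.+-monoʳ-≤ (√-seq n l) (ℚ.≤-trans
      (/-mono 1 (suc l) 1 (suc N) (ℕ.*-monoʳ-≤ 1 (ℕ.s≤s N≤l))) 1/N≤ε)))
  neg-sub : ∀ a b → ℚ.- (a ℚ.- b) ≡ b ℚ.- a
  neg-sub = solve 2 (λ a b → :- (a :- b) := b :- a) refl
    where open +-*-Solver
  bound : ∀ k l → N ℕ.≤ k → N ℕ.≤ l → ∣ √-seq n k ℚ.- √-seq n l ∣ ℚ.≤ ε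
  bound k l N≤k N≤l with ℚ.∣p∣≡p∨∣p∣≡-p (√-seq n k ℚ.- √-seq n l)
  ... | inj₁ eq = subst (ℚ._≤ ε) (sym eq) (one-sided k l N≤l)
  ... | inj₂ eq = subst (ℚ._≤ ε)
    (sym (trans eq (neg-sub (√-seq n k) (√-seq n l)))) (one-sided l k N≤k)

-- The k-th approximation is ⌊(k+1)√n⌋ / (k+1).
√ : ℕ → ℝ
√ n = mkℝ (√-seq n) (√-cauchy n)

=ω[1] : (ℕ → ℝ) → Set
=ω[1] g = ∀ (M : ℕ) → ∃[ N ] (∀ n → N ℕ.≤ n → fromℕ M ≤ᴿ g n)

=o[√n] : (ℕ → ℝ) → Set
=o[√n] g = ∀ ε → 0ℚ ℚ.< ε → ∃[ N ] (∀ n → N ℕ.≤ n → g n ≤ᴿ fromℚ ε *ᴿ √ n)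

-- For n ≥ 1 and x ≥ 0, the real power is n ^ x = inf { n ^ (a/b) : a/b > x }.
-- Hence t ≤ C · n ^ x means t ≤ C · n ^ (a/b), i.e. t ^ b ≤ C ^ b · n ^ a,
-- for every fraction a/b > x.
_≤_·_^ᴿ_ : ℕ → ℕ → ℕ → ℝ → Set
t ≤ C · n ^ᴿ x = ∀ a b .{{_ : NonZero b}} → x <ᴿ fromℚ (+ a / b) →
  t ^ b ℕ.≤ C ^ b ℕ.* n ^ a

_=O[n^_] : (ℕ → ℕ) → ℝ → Set
T =O[n^ x ] = ∃[ C ] ∃[ N ] (∀ n → 1 ℕ.≤ n → N ℕ.≤ n → T n ≤ C · n ^ᴿ x)

Dist : Set → Set
Dist A = List (A × ℝ)

infixl 1 _>>=_

pure : ∀ {A} → A → Dist A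
pure a = (a , 1ᴿ) ∷ []

_>>=_ : ∀ {A B} → Dist A → (A → Dist B) → Dist B
d >>= f = concatMap (λ (a , w) → map (λ (b , v) → b , w *ᴿ v) (f a)) d

Pr : ∀ {A} → (A → Bool) → Dist A → ℝ
Pr E []            = 0ᴿ
Pr E ((a , w) ∷ d) = (if E a then w else 0ᴿ) +ᴿ Pr E d

bernoulli : ℝ → Dist Bool
bernoulli p = (true , p) ∷ (false , 1ᴿ -ᴿ p) ∷ []

uniform : (m : ℕ) → .{{NonZero m}} → Dist (Fin m)
uniform m = map (λ i → i , fromℚ (+ 1 / m)) (allFin m)

iid : ∀ {A} → Dist A → (n : ℕ) → Dist (Vec A n)
iid d zero    = pure []
iid d (suc n) = do
  a ← d
  v ← iid d n
  pure (a ∷ v)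

record SimpleGraph (n : ℕ) : Set where
  field
    adj         : Fin n → Fin n → Bool
    symmetric   : ∀ i j → adj i j ≡ adj j i
    irreflexive : ∀ i → adj i i ≡ false

open SimpleGraph public

mirror : ∀ {n} → (Fin n → Fin n → Bool) → Fin n → Fin n → Bool
mirror e i j with <-cmp i j
... | tri< _ _ _ = e i j
... | tri≈ _ _ _ = false
... | tri> _ _ _ = e j i

mirror-symmetric : ∀ {n} (e : Fin n → Fin n → Bool) i j → mirror e i j ≡ mirror e j i
mirror-symmetric e i j with <-cmp i j | <-cmp j i
... | tri< _ _ _   | tri> _ _ _   = refl
... | tri≈ _ _ _   | tri≈ _ _ _   = refl
... | tri> _ _ _   | tri< _ _ _   = refl
... | tri< a _ _   | tri< _ _ ¬c  = contradiction a ¬c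
... | tri< _ ¬b _  | tri≈ _ b _   = contradiction (sym b) ¬b
... | tri≈ _ b _   | tri< _ ¬b _  = contradiction (sym b) ¬b
... | tri≈ _ b _   | tri> _ ¬b _  = contradiction (sym b) ¬b
... | tri> _ ¬b _  | tri≈ _ b _   = contradiction (sym b) ¬b
... | tri> _ _ c   | tri> ¬a _ _  = contradiction c ¬a

mirror-irreflexive : ∀ {n} (e : Fin n → Fin n → Bool) i → mirror e i i ≡ false
mirror-irreflexive e i with <-cmp i i
... | tri< _ ¬b _ = contradiction refl ¬b
... | tri≈ _ _ _  = refl
... | tri> _ ¬b _ = contradiction refl ¬b

-- The graph in which, for i < j, the pair {i , j} is an edge iff e i j ≡ true;
-- the other values of e are ignored.
fromUpperTriangle : ∀ {n} → (Fin n → Fin n → Bool) → SimpleGraph n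
fromUpperTriangle e = record
  { adj         = mirror e
  ; symmetric   = mirror-symmetric e
  ; irreflexive = mirror-irreflexive e
  }

-- One fair bit per ordered pair, of which only those above the diagonal matter.
fairBits : (n : ℕ) → Dist (Vec (Vec Bool n) n)
fairBits n = iid (iid (bernoulli ½ᴿ) n) n

bit : ∀ {n} → Vec (Vec Bool n) n → Fin n → Fin n → Bool
bit M i j = Vec.lookup (Vec.lookup M i) j

G⟨_,½⟩ : (n : ℕ) → Dist (SimpleGraph n)
G⟨ n ,½⟩ = do
  M ← fairBits n
  pure (fromUpperTriangle (bit M))

-- For p outside [0,1] the weights are not probabilities.  In the use below
-- p = k(n)/n with k(n) = o(n), so this concerns finitely many n only.
Ĝ⟨_,½,_⟩ : (n : ℕ) → ℝ → Dist (SimpleGraph n)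
Ĝ⟨ n ,½, p ⟩ = do
  K ← iid (bernoulli p) n
  M ← fairBits n
  pure (fromUpperTriangle λ i j → (Vec.lookup K i ∧ Vec.lookup K j) ∨ bit M i j)

-- A unit-cost word RAM with oracle access to the adjacency matrix.  Operands
-- are memory addresses, except the constant c, the jump targets ℓ and the output
-- of `halt`.  A uniformly random vertex (or fair coin) is obtained from `random`,
-- which draws uniformly below the word stored at its second operand.
data Instruction : Set where
  const         : (d c : ℕ) → Instruction
  add sub mul   : (d a b : ℕ) → Instruction
  quot rem      : (d a b : ℕ) → Instruction
  load          : (d a : ℕ) → Instruction
  store         : (d a : ℕ) → Instruction
  jump          : (ℓ : ℕ) → Instruction
  jumpIfZero    : (a ℓ : ℕ) → Instruction
  query         : (d i j : ℕ) → Instruction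
  random        : (d a : ℕ) → Instruction
  halt          : (output : Bool) → Instruction

Program : Set
Program = List Instruction

Memory : Set
Memory = ℕ → ℕ

_[_↦_] : Memory → ℕ → ℕ → Memory
(M [ d ↦ v ]) x = if does (x ℕ.≟ d) then v else M x

data Config : Set where
  running : (pc : ℕ) → Memory → Config
  halted  : Bool → Config
  fault   : Config

data Halted : Config → Set where
  halted : ∀ b → Halted (halted b)

outputs : Bool → Config → Bool
outputs true  (halted b) = b
outputs false (halted b) = not b
outputs _     _          = false

entry : ∀ {n} → SimpleGraph n → ℕ → ℕ → Maybe Bool
entry {n} G i j with i ℕ.<? n | j ℕ.<? n
... | yes i<n | yes j<n = just (adj G (fromℕ< i<n) (fromℕ< j<n))
... | _       | _       = nothing

module Machine {n : ℕ} (G : SimpleGraph n) (W : ℕ) .{{_ : NonZero W}} (P : Program) where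

  write : (pc : ℕ) → Memory → (d v : ℕ) → Config
  write pc M d v = running (suc pc) (M [ d ↦ v ℕ.% W ])

  execute : Instruction → (pc : ℕ) → Memory → Dist Config
  execute (const d c)      pc M = pure (write pc M d c)
  execute (add d a b)      pc M = pure (write pc M d (M a ℕ.+ M b))
  execute (sub d a b)      pc M = pure (write pc M d (M a ℕ.∸ M b))
  execute (mul d a b)      pc M = pure (write pc M d (M a ℕ.* M b))
  execute (quot d a b)     pc M with M b
  ... | zero      = pure fault
  ... | m@(suc _) = pure (write pc M d (M a ℕ./ m))
  execute (rem d a b)      pc M with M b
  ... | zero      = pure fault
  ... | m@(suc _) = pure (write pc M d (M a ℕ.% m))
  execute (load d a)       pc M = pure (write pc M d (M (M a)))
  execute (store d a)      pc M = pure (write pc M (M d) (M a))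
  execute (jump ℓ)         pc M = pure (running ℓ M)
  execute (jumpIfZero a ℓ) pc M with M a
  ... | zero  = pure (running ℓ M)
  ... | suc _ = pure (running (suc pc) M)
  execute (query d i j)    pc M with entry G (M i) (M j)
  ... | nothing    = pure fault
  ... | just true  = pure (write pc M d 1)
  ... | just false = pure (write pc M d 0)
  execute (random d a)     pc M with M a
  ... | zero      = pure fault
  ... | m@(suc _) = do
    r ← uniform m
    pure (write pc M d (toℕ r))
  execute (halt b)         pc M = pure (halted b)

  step : Config → Dist Config
  step (running pc M) with head (drop pc P)
  ... | nothing = pure fault
  ... | just I  = execute I pc M
  step (halted b) = pure (halted b)
  step fault      = pure fault

  steps : ℕ → Config → Dist Config
  steps zero    c = pure c
  steps (suc t) c = do
    c′ ← step c
    steps t c′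

  start : Config
  start = running 0 (λ _ → 0)

-- `halts` excludes faults, in particular queries outside the n × n matrix, on
-- every graph and for every outcome of the random choices.
record Algorithm (n : ℕ) : Set where
  field
    wordBound           : ℕ
    {{wordBound-nonZero}} : NonZero wordBound
    program             : Program
    time                : ℕ

  run : SimpleGraph n → Dist Config
  run G = Machine.steps G wordBound program time (Machine.start G wordBound program)

  field
    halts : ∀ G → All (λ (c , _) → Halted c) (run G)

open Algorithm public using (wordBound; program; time; run)

-- Words have O(log n) bits.
record AlgorithmFamily : Set where
  field
    algorithm : ∀ n → Algorithm n
    wordBits  : ∃[ c ] ∃[ N ] (∀ n → N ℕ.≤ n → wordBound (algorithm n) ℕ.≤ n ^ c)

open AlgorithmFamily public

-- The program may depend arbitrarily on n, so its length is charged as well: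
-- otherwise a lookup table would make all computation between queries free.
_RunsInTime_ : AlgorithmFamily → (ℕ → ℕ) → Set
A RunsInTime T = ∀ n →
  (time (algorithm A n) ℕ.≤ T n) × (length (program (algorithm A n)) ℕ.≤ T n)

-- For the problem iidPC_D(n, p): output false is a guess of H₀, true of H₁.
success : ∀ {n} → Algorithm n → ℝ → ℝ
success {n} A p = ½ᴿ *ᴿ
  ( Pr (outputs false) (G⟨ n ,½⟩ >>= run A)
  +ᴿ Pr (outputs true) (Ĝ⟨ n ,½, p ⟩ >>= run A) )

-- For the problems iidPC_D(n, k(n)/n).
_SucceedsAtMost½+o[1]On_ : AlgorithmFamily → (ℕ → ℝ) → Set
A SucceedsAtMost½+o[1]On k = ∀ ε → 0ℚ ℚ.< ε →
  ∃[ N ] (∀ n .{{_ : NonZero n}} → N ℕ.≤ n →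
    success (algorithm A n) (k n /ᴿ n) ≤ᴿ fromℚ (½ ℚ.+ ε))

{-# OPTIONS --safe #-}
module Submission where

-- A_m runs unchanged on a graph with n ≥ m vertices: it never faults, so it only queries
-- the subgraph induced by the first m vertices.  That subgraph of Ĝ(n,½,p) is distributed
-- as Ĝ(m,½,p), and for n = m² the densities agree, as g(n)√n / n = g(m²) / m.  So the
-- family n ↦ A_⌊√n⌋ inherits the success probability of A on squares and runs in time
-- O(⌊√n⌋^(2+2δ)) = O(n^(1+δ)).

open import Defs
open import Data.Nat.Base using (ℕ; _^_)

open import Data.Bool.Base using (Bool; true; false; if_then_else_; _∧_; _∨_)
open import Data.Fin.Base as Fin using (Fin; fromℕ<; inject≤)
import Data.Fin.Properties as Fin
open import Data.Integer.Base using (+_)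
import Data.Integer.Properties as ℤ
open import Data.List.Base using ([]; _∷_; _++_; map; head; drop)
open import Data.List.Relation.Unary.All using (All; []; _∷_)
import Data.List.Relation.Unary.All.Properties as All
open import Data.Maybe.Base using (just; nothing)
open import Data.Nat.Base as ℕ using (zero; suc; NonZero; z≤n; s≤s)
import Data.Nat.Properties as ℕ
import Data.Nat.Tactic.RingSolver as ℕ-Ring
open import Data.Product.Base using (_,_; proj₁; proj₂)
open import Data.Rational.Base as ℚ using (ℚ; 0ℚ; 1ℚ; ½; _/_)
import Data.Rational.Properties as ℚ
open import Data.Rational.Solver using (module +-*-Solver)
import Data.Rational.Unnormalised.Base as ℚᵘ
import Data.Rational.Unnormalised.Properties as ℚᵘ
open import Data.Sum.Base using (_⊎_; inj₁; inj₂; [_,_]′)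
open import Data.Vec.Base as Vec using (Vec; truncate; lookup)
open import Data.Vec.Properties using (lookup-truncate; lookup-map)
open import Function.Base using (_∘_; id)
open import Relation.Binary.Definitions using (tri<; tri≈; tri>)
open import Relation.Binary.PropositionalEquality
open import Relation.Nullary using (yes; no; contradiction; ¬_)

-- Integer square roots.

m²≤n⇒m≤isqrt : ∀ {m n} → m ℕ.* m ℕ.≤ n → m ℕ.≤ isqrt n
m²≤n⇒m≤isqrt {m} {n} m²≤n = ℕ.m<1+n⇒m≤n
  (square-cancel-< m (suc (isqrt n)) (ℕ.≤-<-trans m²≤n (proj₂ (isqrt-spec n))))

isqrt-square : ∀ m → isqrt (m ℕ.* m) ≡ m
isqrt-square m = ℕ.≤-antisym
  (ℕ.≮⇒≥ λ m<r → ℕ.<⇒≱ (ℕ.*-mono-< m<r m<r) (proj₁ (isqrt-spec (m ℕ.* m))))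
  (m²≤n⇒m≤isqrt ℕ.≤-refl)

m≤m*m : ∀ m → m ℕ.≤ m ℕ.* m
m≤m*m zero      = z≤n
m≤m*m m@(suc _) = ℕ.m≤m*n m m

isqrt≤ : ∀ n → isqrt n ℕ.≤ n
isqrt≤ n = ℕ.≤-trans (m≤m*m (isqrt n)) (proj₁ (isqrt-spec n))

m^2≡m*m : ∀ m → m ^ 2 ≡ m ℕ.* m
m^2≡m*m m = cong (m ℕ.*_) (ℕ.*-identityʳ m)

isqrt-^2 : ∀ m → isqrt (m ^ 2) ≡ m
isqrt-^2 m = trans (cong isqrt (m^2≡m*m m)) (isqrt-square m)

-- Running a program unchanged on a larger graph.

AllHalted : Dist Config → Set
AllHalted = All (Halted ∘ proj₁)

-- Every listed outcome counts, whatever its weight, so a property of all outcomes of the bind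
-- passes to each branch `f′ a`. The comparison of `f` with `f′` at `a` may therefore assume it.
All->>=-cong : ∀ {A B} {Q : B → Set} (d : Dist A) {f f′ : A → Dist B} →
  (∀ a → All (Q ∘ proj₁) (f′ a) → f a ≡ f′ a) →
  All (Q ∘ proj₁) (d >>= f′) → (d >>= f) ≡ (d >>= f′)
All->>=-cong []            eq _  = refl
All->>=-cong ((a , w) ∷ d) {f′ = f′} eq ps = cong₂ _++_
  (cong (map _) (eq a (All.map⁻ (All.++⁻ˡ (map _ (f′ a)) ps))))
  (All->>=-cong d eq (All.++⁻ʳ (map _ (f′ a)) ps))

All-pure->>=⁻ : ∀ {A B} {Q : B → Set} (a : A) (f : A → Dist B) →
  All (Q ∘ proj₁) (pure a >>= f) → All (Q ∘ proj₁) (f a)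
All-pure->>=⁻ a f ps = All.map⁻ (All.++⁻ˡ (map _ (f a)) ps)

module Restriction {m n : ℕ} (m≤n : m ℕ.≤ n) {G : SimpleGraph m} {H : SimpleGraph n}
  (G≡H : ∀ i j → adj G i j ≡ adj H (inject≤ i m≤n) (inject≤ j m≤n))
  (W : ℕ) .{{_ : NonZero W}} (P : Program) where

  private
    module Mᴳ = Machine G W P
    module Mᴴ = Machine H W P

  -- Only one direction can hold: `H` also answers queries beyond the first `m` vertices, where `G`
  -- gives `nothing`.
  entry-restrict : ∀ i j b → entry G i j ≡ just b → entry H i j ≡ just b
  entry-restrict i j b eq with i ℕ.<? m | j ℕ.<? m | i ℕ.<? n | j ℕ.<? n
  ... | yes i<m | yes j<m | yes i<n | yes j<n = trans (cong just (begin
        adj H (fromℕ< i<n) (fromℕ< j<n)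
          ≡⟨ cong₂ (adj H) (inject i<m i<n) (inject j<m j<n) ⟨
        adj H (inject≤ (fromℕ< i<m) m≤n) (inject≤ (fromℕ< j<m) m≤n)
          ≡⟨ G≡H (fromℕ< i<m) (fromℕ< j<m) ⟨
        adj G (fromℕ< i<m) (fromℕ< j<m) ∎)) eq
    where
    open ≡-Reasoning
    inject : ∀ {k} (k<m : k ℕ.< m) (k<n : k ℕ.< n) → inject≤ (fromℕ< k<m) m≤n ≡ fromℕ< k<n
    inject k<m k<n = Fin.toℕ-injective (trans (Fin.toℕ-inject≤ _ m≤n)
      (trans (Fin.toℕ-fromℕ< k<m) (sym (Fin.toℕ-fromℕ< k<n))))
  ... | yes i<m | _ | no i≮n | _ = contradiction (ℕ.<-≤-trans i<m m≤n) i≮n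
  ... | _ | yes j<m | _ | no j≮n = contradiction (ℕ.<-≤-trans j<m m≤n) j≮n

  -- Only `query` looks at the graph, and the two machines can part there only when the smaller one
  -- faults.
  execute-restrict : ∀ I pc M →
    Mᴴ.execute I pc M ≡ Mᴳ.execute I pc M ⊎ Mᴳ.execute I pc M ≡ pure fault
  execute-restrict (const d c)      pc M = inj₁ refl
  execute-restrict (add d a b)      pc M = inj₁ refl
  execute-restrict (sub d a b)      pc M = inj₁ refl
  execute-restrict (mul d a b)      pc M = inj₁ refl
  execute-restrict (quot d a b)     pc M with M b
  ... | zero  = inj₁ refl
  ... | suc _ = inj₁ refl
  execute-restrict (rem d a b)      pc M with M b
  ... | zero  = inj₁ refl
  ... | suc _ = inj₁ refl
  execute-restrict (load d a)       pc M = inj₁ refl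
  execute-restrict (store d a)      pc M = inj₁ refl
  execute-restrict (jump ℓ)         pc M = inj₁ refl
  execute-restrict (jumpIfZero a ℓ) pc M with M a
  ... | zero  = inj₁ refl
  ... | suc _ = inj₁ refl
  execute-restrict (query d i j)    pc M with entry G (M i) (M j) in eq
  ... | nothing    = inj₂ refl
  ... | just true  rewrite entry-restrict (M i) (M j) true eq  = inj₁ refl
  ... | just false rewrite entry-restrict (M i) (M j) false eq = inj₁ refl
  execute-restrict (random d a)     pc M with M a
  ... | zero  = inj₁ refl
  ... | suc _ = inj₁ refl
  execute-restrict (halt b)         pc M = inj₁ refl

  step-restrict : ∀ c → Mᴴ.step c ≡ Mᴳ.step c ⊎ Mᴳ.step c ≡ pure fault
  step-restrict (running pc M) with head (drop pc P)
  ... | nothing = inj₁ refl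
  ... | just I  = execute-restrict I pc M
  step-restrict (halted b) = inj₁ refl
  step-restrict fault      = inj₁ refl

  fault-persists : ∀ t → ¬ AllHalted (Mᴳ.steps t fault)
  fault-persists zero    (() ∷ _)
  fault-persists (suc t) hs = fault-persists t (All-pure->>=⁻ {Q = Halted} fault (Mᴳ.steps t) hs)

  -- The first step at which the machines could differ is a fault of the smaller one. A fault is
  -- absorbing, which contradicts halting on every branch. The two runs are thus equal even as
  -- weighted lists.
  steps-restrict : ∀ t c → AllHalted (Mᴳ.steps t c) → Mᴴ.steps t c ≡ Mᴳ.steps t c
  steps-restrict zero    c hs = refl
  steps-restrict (suc t) c hs = [ same , faulty ]′ (step-restrict c)
    where
    same : Mᴴ.step c ≡ Mᴳ.step c → Mᴴ.steps (suc t) c ≡ Mᴳ.steps (suc t) c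
    same eq = trans (cong (_>>= Mᴴ.steps t) eq)
      (All->>=-cong {Q = Halted} (Mᴳ.step c) (steps-restrict t) hs)
    faulty : Mᴳ.step c ≡ pure fault → Mᴴ.steps (suc t) c ≡ Mᴳ.steps (suc t) c
    faulty eq = contradiction
      (All-pure->>=⁻ {Q = Halted} fault (Mᴳ.steps t)
        (subst (λ d → AllHalted (d >>= Mᴳ.steps t)) eq hs))
      (fault-persists t)

inducedSubgraph : ∀ {m n} → m ℕ.≤ n → SimpleGraph n → SimpleGraph m
inducedSubgraph m≤n H = record
  { adj         = λ i j → adj H (inject≤ i m≤n) (inject≤ j m≤n)
  ; symmetric   = λ i j → symmetric H (inject≤ i m≤n) (inject≤ j m≤n)
  ; irreflexive = λ i → irreflexive H (inject≤ i m≤n)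
  }

module _ {m n : ℕ} (m≤n : m ℕ.≤ n) (A : Algorithm m) where

  private instance _ = Algorithm.wordBound-nonZero A

  private
    -- Phrased with `Machine.steps` because the field `halts` of `extend` already depends on it.
    simulates : ∀ {G H} → (∀ i j → adj G i j ≡ adj H (inject≤ i m≤n) (inject≤ j m≤n)) →
      Machine.steps H (wordBound A) (program A) (time A) (Machine.start H (wordBound A) (program A))
        ≡ run A G
    simulates {G} {H} G≡H = Restriction.steps-restrict m≤n {G} {H} G≡H (wordBound A) (program A)
      (time A) (Machine.start G (wordBound A) (program A)) (Algorithm.halts A G)

  extend : Algorithm n
  extend = record
    { wordBound = wordBound A
    ; program   = program A
    ; time      = time A
    -- Halting on `H` is inherited from the run of `A` on the subgraph that `H` induces on the first
    -- `m` vertices.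
    ; halts     = λ H → subst AllHalted
        (sym (simulates {inducedSubgraph m≤n H} {H} λ _ _ → refl))
        (Algorithm.halts A (inducedSubgraph m≤n H))
    }

  -- Any `G` with the right adjacencies is allowed, not just `inducedSubgraph m≤n H`: identifying
  -- the two records would call for function extensionality.
  run-extend : ∀ {G H} → (∀ i j → adj G i j ≡ adj H (inject≤ i m≤n) (inject≤ j m≤n)) →
    run extend H ≡ run A G
  run-extend {G} {H} G≡H = simulates {G} {H} G≡H

-- Marginals of product distributions.

-- Real-number equality is not needed: marginalisation holds exactly in ℚ at each
-- index k of the approximating sequences.
module Expectation (k : ℕ) where

  -- A formal weighted sum: the weights at index `k` may be negative, and the arguments below use
  -- only linearity and total mass 1.
  𝔼 : ∀ {A} → Dist A → (A → ℚ) → ℚ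
  𝔼 []            F = 0ℚ
  𝔼 ((a , w) ∷ d) F = seq w k ℚ.* F a ℚ.+ 𝔼 d F

  𝟙 : Bool → ℚ
  𝟙 b = if b then 1ℚ else 0ℚ

  Pr≡𝔼 : ∀ {A} (E : A → Bool) (d : Dist A) → seq (Pr E d) k ≡ 𝔼 d (𝟙 ∘ E)
  Pr≡𝔼 E []            = refl
  Pr≡𝔼 E ((a , w) ∷ d) with E a
  ... | true  = cong₂ ℚ._+_ (sym (ℚ.*-identityʳ (seq w k))) (Pr≡𝔼 E d)
  ... | false = cong₂ ℚ._+_ (sym (ℚ.*-zeroʳ (seq w k))) (Pr≡𝔼 E d)

  𝔼-cong : ∀ {A} (d : Dist A) {F F′ : A → ℚ} → (∀ a → F a ≡ F′ a) → 𝔼 d F ≡ 𝔼 d F′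
  𝔼-cong []            eq = refl
  𝔼-cong ((a , w) ∷ d) eq = cong₂ (λ x y → seq w k ℚ.* x ℚ.+ y) (eq a) (𝔼-cong d eq)

  𝔼-++ : ∀ {A} (d d′ : Dist A) F → 𝔼 (d ++ d′) F ≡ 𝔼 d F ℚ.+ 𝔼 d′ F
  𝔼-++ []            d′ F = sym (ℚ.+-identityˡ (𝔼 d′ F))
  𝔼-++ ((a , w) ∷ d) d′ F = trans (cong (seq w k ℚ.* F a ℚ.+_) (𝔼-++ d d′ F))
    (sym (ℚ.+-assoc (seq w k ℚ.* F a) (𝔼 d F) (𝔼 d′ F)))

  𝔼-scale : ∀ {A} (w : ℝ) (d : Dist A) F →
    𝔼 (map (λ (a , v) → a , w *ᴿ v) d) F ≡ seq w k ℚ.* 𝔼 d F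
  𝔼-scale w []            F = sym (ℚ.*-zeroʳ (seq w k))
  𝔼-scale w ((a , v) ∷ d) F = trans
    (cong₂ ℚ._+_ (ℚ.*-assoc (seq w k) (seq v k) (F a)) (𝔼-scale w d F))
    (sym (ℚ.*-distribˡ-+ (seq w k) (seq v k ℚ.* F a) (𝔼 d F)))

  𝔼-pure : ∀ {A} (a : A) F → 𝔼 (pure a) F ≡ F a
  𝔼-pure a F = trans (ℚ.+-identityʳ (1ℚ ℚ.* F a)) (ℚ.*-identityˡ (F a))

  𝔼->>= : ∀ {A B} (d : Dist A) (f : A → Dist B) F → 𝔼 (d >>= f) F ≡ 𝔼 d (λ a → 𝔼 (f a) F)
  𝔼->>= []            f F = refl
  𝔼->>= ((a , w) ∷ d) f F = trans (𝔼-++ (map _ (f a)) (d >>= f) F)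
    (cong₂ ℚ._+_ (𝔼-scale w (f a) F) (𝔼->>= d f F))

  𝔼->>=-pure : ∀ {A B} (d : Dist A) (f : A → B) F → 𝔼 (d >>= (pure ∘ f)) F ≡ 𝔼 d (F ∘ f)
  𝔼->>=-pure d f F = trans (𝔼->>= d (pure ∘ f) F) (𝔼-cong d λ a → 𝔼-pure (f a) F)

  Normalised : ∀ {A} → Dist A → Set
  Normalised d = ∀ c → 𝔼 d (λ _ → c) ≡ c

  -- The pushforward of `d` along `h` is `d′`, tested against rational functions since the
  -- underlying lists differ.
  Projects : ∀ {A B} → (A → B) → Dist A → Dist B → Set
  Projects h d d′ = ∀ F → 𝔼 d (F ∘ h) ≡ 𝔼 d′ F

  𝔼-iid-suc : ∀ {A} (d : Dist A) n F →
    𝔼 (iid d (suc n)) F ≡ 𝔼 d (λ a → 𝔼 (iid d n) (λ v → F (a Vec.∷ v)))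
  𝔼-iid-suc d n F = trans (𝔼->>= d (λ a → iid d n >>= λ v → pure (a Vec.∷ v)) F)
    (𝔼-cong d λ a → 𝔼->>=-pure (iid d n) (a Vec.∷_) F)

  iid-normalised : ∀ {A} {d : Dist A} → Normalised d → ∀ n → Normalised (iid d n)
  iid-normalised {A}     nd zero    c = 𝔼-pure {Vec A 0} Vec.[] (λ _ → c)
  iid-normalised {d = d} nd (suc n) c = trans (𝔼-iid-suc d n (λ _ → c))
    (trans (𝔼-cong d λ _ → iid-normalised nd n c) (nd c))

  -- Kept coordinates are matched one by one through `pr`; dropped ones contribute total mass 1. The
  -- map `h` on entries lets the same lemma serve for the rows and for the matrix made of rows.
  iid-projects : ∀ {A B} {h : A → B} {d d′} → Normalised d → Projects h d d′ →
    ∀ {m n} (m≤n : m ℕ.≤ n) → Projects (Vec.map h ∘ truncate m≤n) (iid d n) (iid d′ m)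
  -- All `n` remaining coordinates are dropped here, and the integrand is constant.
  iid-projects nd pr {n = n} z≤n F =
    trans (iid-normalised nd n (F Vec.[])) (sym (𝔼-pure Vec.[] F))
  iid-projects {h = h} {d} {d′} nd pr {suc m} {suc n} (s≤s m≤n) F = begin
      𝔼 (iid d (suc n)) (F ∘ Vec.map h ∘ truncate (s≤s m≤n))
        ≡⟨ 𝔼-iid-suc d n (F ∘ Vec.map h ∘ truncate (s≤s m≤n)) ⟩
      𝔼 d (λ a → 𝔼 (iid d n) (λ v → F (h a Vec.∷ Vec.map h (truncate m≤n v))))
        ≡⟨ 𝔼-cong d (λ a → iid-projects nd pr m≤n (F ∘ (h a Vec.∷_))) ⟩
      𝔼 d (λ a → 𝔼 (iid d′ m) (λ v → F (h a Vec.∷ v)))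
        ≡⟨ pr (λ b → 𝔼 (iid d′ m) (λ v → F (b Vec.∷ v))) ⟩
      𝔼 d′ (λ b → 𝔼 (iid d′ m) (λ v → F (b Vec.∷ v)))
        ≡⟨ 𝔼-iid-suc d′ m F ⟨
      𝔼 (iid d′ (suc m)) F ∎
    where open ≡-Reasoning

  -- A polynomial identity, hence valid also for `p` outside [0,1].
  bernoulli-normalised : ∀ p → Normalised (bernoulli p)
  bernoulli-normalised p c = lemma (seq p k) c
    where
    lemma : ∀ x c → x ℚ.* c ℚ.+ ((1ℚ ℚ.+ ℚ.- x) ℚ.* c ℚ.+ 0ℚ) ≡ c
    lemma = solve 2 (λ x c → x :* c :+ ((con 1ℚ :+ :- x) :* c :+ con 0ℚ) := c) refl
      where open +-*-Solver

  -- The densities of the two problems are different sequences that agree at index `k`; this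
  -- exchanges one for the other.
  bernoulli-cong : ∀ {p p′} → seq p k ≡ seq p′ k → Projects id (bernoulli p) (bernoulli p′)
  bernoulli-cong eq F =
    cong (λ x → x ℚ.* F true ℚ.+ ((1ℚ ℚ.+ ℚ.- x) ℚ.* F false ℚ.+ 0ℚ)) eq

-- Restricting the random graphs to the first vertices.

lookup-prefix : ∀ {A B : Set} (h : A → B) {m n} (m≤n : m ℕ.≤ n) (v : Vec A n) i →
  lookup (Vec.map h (truncate m≤n v)) i ≡ h (lookup v (inject≤ i m≤n))
lookup-prefix h m≤n v i = trans (lookup-map i h (truncate m≤n v)) (cong h (lookup-truncate m≤n v i))

inject≤-mono-< : ∀ {m n} (m≤n : m ℕ.≤ n) {i j : Fin m} → i Fin.< j → inject≤ i m≤n Fin.< inject≤ j m≤n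
inject≤-mono-< m≤n {i} {j} i<j =
  subst₂ ℕ._<_ (sym (Fin.toℕ-inject≤ i m≤n)) (sym (Fin.toℕ-inject≤ j m≤n)) i<j

-- `inject≤` preserves the order of vertices, so both graphs read a pair in the same orientation;
-- the mixed cases are impossible.
mirror-restrict : ∀ {m n} (m≤n : m ℕ.≤ n) {e : Fin m → Fin m → Bool} {f : Fin n → Fin n → Bool} →
  (∀ i j → e i j ≡ f (inject≤ i m≤n) (inject≤ j m≤n)) →
  ∀ i j → mirror e i j ≡ mirror f (inject≤ i m≤n) (inject≤ j m≤n)
mirror-restrict m≤n e≡f i j with Fin.<-cmp i j | Fin.<-cmp (inject≤ i m≤n) (inject≤ j m≤n)
... | tri< _ _ _ | tri< _ _ _  = e≡f i j
... | tri≈ _ _ _ | tri≈ _ _ _  = refl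
... | tri> _ _ _ | tri> _ _ _  = e≡f j i
... | tri< a _ _ | tri≈ ¬a _ _ = contradiction (inject≤-mono-< m≤n a) ¬a
... | tri< a _ _ | tri> ¬a _ _ = contradiction (inject≤-mono-< m≤n a) ¬a
... | tri≈ _ b _ | tri< _ ¬b _ = contradiction (cong (λ i → inject≤ i m≤n) b) ¬b
... | tri≈ _ b _ | tri> _ ¬b _ = contradiction (cong (λ i → inject≤ i m≤n) b) ¬b
... | tri> _ _ c | tri< _ _ ¬c = contradiction (inject≤-mono-< m≤n c) ¬c
... | tri> _ _ c | tri≈ _ _ ¬c = contradiction (inject≤-mono-< m≤n c) ¬c

module _ {m n : ℕ} (m≤n : m ℕ.≤ n) (A : Algorithm m) (k : ℕ) where

  open Expectation k

  -- The inner `Vec.map id` changes nothing; it gives the map the shape produced by applying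
  -- `iid-projects` twice.
  topLeft : Vec (Vec Bool n) n → Vec (Vec Bool m) m
  topLeft = Vec.map (Vec.map id ∘ truncate m≤n) ∘ truncate m≤n

  bit-topLeft : ∀ M i j → bit (topLeft M) i j ≡ bit M (inject≤ i m≤n) (inject≤ j m≤n)
  bit-topLeft M i j = trans
    (cong (λ r → lookup r j) (lookup-prefix (Vec.map id ∘ truncate m≤n) m≤n M i))
    (lookup-prefix id m≤n (lookup M (inject≤ i m≤n)) j)

  fairRow-normalised : ∀ n → Normalised (iid (bernoulli ½ᴿ) n)
  fairRow-normalised n = iid-normalised (bernoulli-normalised ½ᴿ) n

  fairBits-projects : Projects topLeft (fairBits n) (fairBits m)
  fairBits-projects = iid-projects (fairRow-normalised n)
    (iid-projects (bernoulli-normalised ½ᴿ) (bernoulli-cong {½ᴿ} {½ᴿ} refl) m≤n) m≤n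

  Pr-null : ∀ E → seq (Pr E (G⟨ n ,½⟩ >>= run (extend m≤n A))) k ≡ seq (Pr E (G⟨ m ,½⟩ >>= run A)) k
  Pr-null E = begin
      seq (Pr E (G⟨ n ,½⟩ >>= run (extend m≤n A))) k
        ≡⟨ expand (extend m≤n A) ⟩
      𝔼 (fairBits n) (λ M → 𝔼 (run (extend m≤n A) (fromUpperTriangle (bit M))) (𝟙 ∘ E))
        -- Sample by sample, the run on the large graph is the run of `A` on the graph built from
        -- the top left block.
        ≡⟨ 𝔼-cong (fairBits n) (λ M → cong (λ d → 𝔼 d (𝟙 ∘ E))
             (run-extend m≤n A (mirror-restrict m≤n (bit-topLeft M)))) ⟩
      𝔼 (fairBits n) (λ M → 𝔼 (run A (fromUpperTriangle (bit (topLeft M)))) (𝟙 ∘ E))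
        ≡⟨ fairBits-projects (λ M → 𝔼 (run A (fromUpperTriangle (bit M))) (𝟙 ∘ E)) ⟩
      𝔼 (fairBits m) (λ M → 𝔼 (run A (fromUpperTriangle (bit M))) (𝟙 ∘ E))
        ≡⟨ expand A ⟨
      seq (Pr E (G⟨ m ,½⟩ >>= run A)) k ∎
    where
    open ≡-Reasoning
    expand : ∀ {l} (A : Algorithm l) → seq (Pr E (G⟨ l ,½⟩ >>= run A)) k ≡
      𝔼 (fairBits l) (λ M → 𝔼 (run A (fromUpperTriangle (bit M))) (𝟙 ∘ E))
    expand {l} A = trans (Pr≡𝔼 E (G⟨ l ,½⟩ >>= run A)) (trans (𝔼->>= G⟨ l ,½⟩ (run A) (𝟙 ∘ E))
      (𝔼->>=-pure (fairBits l) (λ M → fromUpperTriangle (bit M)) (λ G → 𝔼 (run A G) (𝟙 ∘ E))))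

  plantedGraph : ∀ {l} → Vec Bool l → Vec (Vec Bool l) l → SimpleGraph l
  plantedGraph K M = fromUpperTriangle λ i j → (lookup K i ∧ lookup K j) ∨ bit M i j

  Pr-planted : ∀ {p p′} → seq p k ≡ seq p′ k → ∀ E →
    seq (Pr E (Ĝ⟨ n ,½, p ⟩ >>= run (extend m≤n A))) k ≡ seq (Pr E (Ĝ⟨ m ,½, p′ ⟩ >>= run A)) k
  Pr-planted {p} {p′} p≡p′ E = begin
      seq (Pr E (Ĝ⟨ n ,½, p ⟩ >>= run (extend m≤n A))) k
        ≡⟨ expand p (extend m≤n A) ⟩
      𝔼 (iid (bernoulli p) n) (λ K → 𝔼 (fairBits n) (λ M → accept (extend m≤n A) K M))
        ≡⟨ 𝔼-cong (iid (bernoulli p) n) (λ K → 𝔼-cong (fairBits n) (λ M → cong (λ d → 𝔼 d (𝟙 ∘ E))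
             (run-extend m≤n A (mirror-restrict m≤n (λ i j → cong₂ _∨_
               (cong₂ _∧_ (lookup-prefix id m≤n K i) (lookup-prefix id m≤n K j))
               (bit-topLeft M i j)))))) ⟩
      𝔼 (iid (bernoulli p) n) (λ K → 𝔼 (fairBits n) (λ M → accept A (top K) (topLeft M)))
        -- The bits are marginalised first, with `K` fixed; then `K` itself, which also replaces `p`
        -- by `p′`.
        ≡⟨ 𝔼-cong (iid (bernoulli p) n) (λ K → fairBits-projects (accept A (top K))) ⟩
      𝔼 (iid (bernoulli p) n) (λ K → 𝔼 (fairBits m) (accept A (top K)))
        ≡⟨ iid-projects (bernoulli-normalised p) (bernoulli-cong {p} {p′} p≡p′) m≤n
             (λ K → 𝔼 (fairBits m) (accept A K)) ⟩
      𝔼 (iid (bernoulli p′) m) (λ K → 𝔼 (fairBits m) (accept A K))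
        ≡⟨ expand p′ A ⟨
      seq (Pr E (Ĝ⟨ m ,½, p′ ⟩ >>= run A)) k ∎
    where
    open ≡-Reasoning
    accept : ∀ {l} → Algorithm l → Vec Bool l → Vec (Vec Bool l) l → ℚ
    accept A K M = 𝔼 (run A (plantedGraph K M)) (𝟙 ∘ E)
    top : Vec Bool n → Vec Bool m
    top = Vec.map id ∘ truncate m≤n
    expand : ∀ {l} p (A : Algorithm l) → seq (Pr E (Ĝ⟨ l ,½, p ⟩ >>= run A)) k ≡
      𝔼 (iid (bernoulli p) l) (λ K → 𝔼 (fairBits l) (accept A K))
    expand {l} p A = trans (Pr≡𝔼 E (Ĝ⟨ l ,½, p ⟩ >>= run A)) (trans
      (𝔼->>= Ĝ⟨ l ,½, p ⟩ (run A) (𝟙 ∘ E)) (trans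
      (𝔼->>= (iid (bernoulli p) l) (λ K → fairBits l >>= λ M → pure (plantedGraph K M))
        (λ G → 𝔼 (run A G) (𝟙 ∘ E)))
      (𝔼-cong (iid (bernoulli p) l) λ K →
        𝔼->>=-pure (fairBits l) (plantedGraph K) (λ G → 𝔼 (run A G) (𝟙 ∘ E)))))

  success-extend : ∀ {p p′} → seq p k ≡ seq p′ k →
    seq (success (extend m≤n A) p) k ≡ seq (success A p′) k
  success-extend {p} {p′} p≡p′ = cong (½ ℚ.*_)
    (cong₂ ℚ._+_ (Pr-null (outputs false)) (Pr-planted {p} {p′} p≡p′ (outputs true)))

-- Agreement of the densities at square numbers of vertices.

/-cross : ∀ a b c d .{{_ : NonZero b}} .{{_ : NonZero d}} →
  a ℕ.* d ≡ c ℕ.* b → + a / b ≡ + c / d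
/-cross a b c d eq = ℚ.≤-antisym
  (/-mono a b c d (ℕ.≤-reflexive eq)) (/-mono c d a b (ℕ.≤-reflexive (sym eq)))

/-*-/ : ∀ a b c d .{{_ : NonZero b}} .{{_ : NonZero d}} .{{_ : NonZero (b ℕ.* d)}} →
  (+ a / b) ℚ.* (+ c / d) ≡ + (a ℕ.* c) / (b ℕ.* d)
/-*-/ a b@(suc _) c d@(suc _) = ℚ.toℚᵘ-injective (begin
    ℚ.toℚᵘ ((+ a / b) ℚ.* (+ c / d))          ≈⟨ ℚ.toℚᵘ-homo-* (+ a / b) (+ c / d) ⟩
    ℚ.toℚᵘ (+ a / b) ℚᵘ.* ℚ.toℚᵘ (+ c / d)    ≈⟨ ℚᵘ.*-cong (ℚ.toℚᵘ-fromℚᵘ (+ a ℚᵘ./ b)) (ℚ.toℚᵘ-fromℚᵘ (+ c ℚᵘ./ d)) ⟩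
    (+ a ℚᵘ./ b) ℚᵘ.* (+ c ℚᵘ./ d)            ≡⟨ cong (λ z → z ℚᵘ./ (b ℕ.* d)) (ℤ.pos-* a c) ⟨
    + (a ℕ.* c) ℚᵘ./ (b ℕ.* d)                ≈⟨ ℚ.toℚᵘ-fromℚᵘ (+ (a ℕ.* c) ℚᵘ./ (b ℕ.* d)) ⟨
    ℚ.toℚᵘ (+ (a ℕ.* c) / (b ℕ.* d))          ∎)
  where open ℚᵘ.≃-Reasoning

-- At a perfect square the floor in the approximation loses nothing, so every term already equals
-- the root.
√-square-seq : ∀ n k → √-seq (n ^ 2) k ≡ + (n ℕ.* suc k) / suc k
√-square-seq n k = cong (λ r → + r / suc k)
  (trans (cong isqrt (rearrange n (suc k))) (isqrt-square (n ℕ.* suc k)))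
  where
  rearrange : ∀ n l → n ℕ.* (n ℕ.* 1) ℕ.* (l ℕ.* l) ≡ n ℕ.* l ℕ.* (n ℕ.* l)
  rearrange = ℕ-Ring.solve-∀

-- Since √(n²)/n² = 1/n holds exactly at each index, the two densities agree termwise and not merely
-- in the limit.
√-square/ : ∀ x n .{{_ : NonZero n}} .{{_ : NonZero (n ^ 2)}} k →
  seq (x *ᴿ √ (n ^ 2) /ᴿ (n ^ 2)) k ≡ seq (x /ᴿ n) k
√-square/ x n@(suc _) k = trans (ℚ.*-assoc (seq x k) (√-seq (n ^ 2) k) (+ 1 / n ^ 2))
  (cong (seq x k ℚ.*_) (begin
    √-seq (n ^ 2) k ℚ.* (+ 1 / n ^ 2)              ≡⟨ cong (ℚ._* (+ 1 / n ^ 2)) (√-square-seq n k) ⟩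
    (+ (n ℕ.* suc k) / suc k) ℚ.* (+ 1 / n ^ 2)    ≡⟨ /-*-/ (n ℕ.* suc k) (suc k) 1 (n ^ 2) ⟩
    + (n ℕ.* suc k ℕ.* 1) / (suc k ℕ.* n ^ 2)      ≡⟨ /-cross (n ℕ.* suc k ℕ.* 1) (suc k ℕ.* n ^ 2) 1 n
                                                         (rearrange n (suc k)) ⟩
    + 1 / n                                        ∎))
  where
  open ≡-Reasoning
  rearrange : ∀ n l → n ℕ.* l ℕ.* 1 ℕ.* n ≡ 1 ℕ.* (l ℕ.* (n ℕ.* (n ℕ.* 1)))
  rearrange = ℕ-Ring.solve-∀

-- Real inequalities and growth exponents.

≤ᴿ-congˡ : ∀ {x x′ y} → (∀ k → seq x k ≡ seq x′ k) → x ≤ᴿ y → x′ ≤ᴿ y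
≤ᴿ-congˡ {y = y} x≡x′ x≤y ε 0<ε =
  proj₁ (x≤y ε 0<ε) , λ k N≤k →
    subst (ℚ._≤ seq y k ℚ.+ ε) (x≡x′ k) (proj₂ (x≤y ε 0<ε) k N≤k)

double-<ᴿ : ∀ δ a b .{{_ : NonZero b}} → 1ᴿ +ᴿ δ <ᴿ fromℚ (+ a / b) →
  fromℕ 2 +ᴿ fromℕ 2 *ᴿ δ <ᴿ fromℚ (+ (2 ℕ.* a) / b)
-- Doubling the inequality doubles the gap to `ε + ε`, and tolerance `η` comes from tolerance `η`/2
-- in `le`.
double-<ᴿ δ a b (ε , 0<ε , le) = ε ℚ.+ ε , ℚ.+-mono-< 0<ε 0<ε , λ η 0<η →
  let N , bound = le (½ ℚ.* η) (ℚ.positive⁻¹ _ {{ℚ.pos*pos⇒pos ½ η {{ℚ.positive 0<η}}}}) in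
  N , λ k N≤k → subst₂ ℚ._≤_ (lhs (seq δ k) ε)
    (trans (rhs (+ a / b) η) (cong (ℚ._+ η) (double b)))
    (ℚ.*-monoˡ-≤-nonNeg 2ℚ (bound k N≤k))
  where
  2ℚ : ℚ
  2ℚ = + 2 / 1
  open +-*-Solver
  lhs : ∀ d e → 2ℚ ℚ.* (1ℚ ℚ.+ d ℚ.+ e) ≡ 2ℚ ℚ.+ 2ℚ ℚ.* d ℚ.+ (e ℚ.+ e)
  lhs = solve 2 (λ d e → con 2ℚ :* (con 1ℚ :+ d :+ e) := con 2ℚ :+ con 2ℚ :* d :+ (e :+ e)) refl
  rhs : ∀ r e → 2ℚ ℚ.* (r ℚ.+ ½ ℚ.* e) ≡ 2ℚ ℚ.* r ℚ.+ e
  rhs = solve 2 (λ r e → con 2ℚ :* (r :+ con ½ :* e) := con 2ℚ :* r :+ e) refl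
  double : ∀ b .{{_ : NonZero b}} → 2ℚ ℚ.* (+ a / b) ≡ + (2 ℕ.* a) / b
  double b@(suc _) = trans (/-*-/ 2 1 a b) (/-cross (2 ℕ.* a) (1 ℕ.* b) (2 ℕ.* a) b
    (cong (2 ℕ.* a ℕ.*_) (sym (ℕ.*-identityˡ b))))

-- With r = ⌊√n⌋, r^(2+2δ) = (r²)^(1+δ) is at most n^(1+δ). For a fraction a/b above 1+δ, the bound
-- on `T` is applied with 2a/b.
isqrt-time : ∀ δ T → T =O[n^ fromℕ 2 +ᴿ fromℕ 2 *ᴿ δ ] → (T ∘ isqrt) =O[n^ 1ᴿ +ᴿ δ ]
-- The constant is kept; the threshold is squared so that ⌊√n⌋ reaches `N`.
isqrt-time δ T (C , N , bound) = C , N ℕ.* N , λ n 1≤n NN≤n a b lt →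
  let r = isqrt n in begin
    T r ^ b                    ≤⟨ bound r (m²≤n⇒m≤isqrt 1≤n) (m²≤n⇒m≤isqrt NN≤n) (2 ℕ.* a) b
                                    (double-<ᴿ δ a b lt) ⟩
    C ^ b ℕ.* r ^ (2 ℕ.* a)    ≡⟨ cong (C ^ b ℕ.*_) (ℕ.^-*-assoc r 2 a) ⟨
    C ^ b ℕ.* (r ^ 2) ^ a      ≡⟨ cong (λ s → C ^ b ℕ.* s ^ a) (m^2≡m*m r) ⟩
    C ^ b ℕ.* (r ℕ.* r) ^ a    ≤⟨ ℕ.*-monoʳ-≤ (C ^ b) (ℕ.^-monoˡ-≤ a (proj₁ (isqrt-spec n))) ⟩
    C ^ b ℕ.* n ^ a            ∎
  where open ℕ.≤-Reasoning

-- The reduction between families.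

squareRootFamily : AlgorithmFamily → AlgorithmFamily
squareRootFamily A = record
  { algorithm = λ n → extend (isqrt≤ n) (algorithm A (isqrt n))
  ; wordBits  = let c , N , bound = wordBits A in
      c , N ℕ.* N , λ n NN≤n →
        ℕ.≤-trans (bound (isqrt n) (m²≤n⇒m≤isqrt NN≤n)) (ℕ.^-monoˡ-≤ c (isqrt≤ n))
  }

-- `isqrt (n ^ 2)` does not compute to `n`, so the root is a variable `n₂` with an equation, and
-- matching on `refl` aligns the two algorithms.
success-squareRootFamily : ∀ A {n₁ n₂} → isqrt n₁ ≡ n₂ → ∀ p₁ p₂ y →
  (∀ k → seq p₁ k ≡ seq p₂ k) →
  success (algorithm (squareRootFamily A) n₁) p₁ ≤ᴿ y → success (algorithm A n₂) p₂ ≤ᴿ y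
success-squareRootFamily A {n₁} refl p₁ p₂ y p₁≡p₂ = ≤ᴿ-congˡ
  {success (algorithm (squareRootFamily A) n₁) p₁} {success (algorithm A (isqrt n₁)) p₂} {y}
  (λ k → success-extend (isqrt≤ n₁) (algorithm A (isqrt n₁)) k {p₁} {p₂} (p₁≡p₂ k))

success-square : ∀ A x y n .{{_ : NonZero n}} .{{_ : NonZero (n ^ 2)}} →
  success (algorithm (squareRootFamily A) (n ^ 2)) (x *ᴿ √ (n ^ 2) /ᴿ (n ^ 2)) ≤ᴿ y →
  success (algorithm A n) (x /ᴿ n) ≤ᴿ y
success-square A x y n {{n≢0}} {{n²≢0}} = success-squareRootFamily A {n ^ 2} {n} (isqrt-^2 n)
  (_/ᴿ_ (x *ᴿ √ (n ^ 2)) (n ^ 2) {{n²≢0}}) (_/ᴿ_ x n {{n≢0}}) y (√-square/ x n {{n≢0}} {{n²≢0}})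

succeeds-square : ∀ A (g : ℕ → ℝ) →
  squareRootFamily A SucceedsAtMost½+o[1]On (λ n → g n *ᴿ √ n) →
  A SucceedsAtMost½+o[1]On (λ n → g (n ^ 2))
-- The threshold carries over unchanged, because n² is at least n.
succeeds-square A g succ ε 0<ε = proj₁ (succ ε 0<ε) , λ n {{n≢0}} N≤n →
  success-square A (g (n ^ 2)) (fromℚ (½ ℚ.+ ε)) n {{n≢0}} {{ℕ.m^n≢0 n 2 {{n≢0}}}}
    (proj₂ (succ ε 0<ε) (n ^ 2) {{ℕ.m^n≢0 n 2 {{n≢0}}}}
      (ℕ.≤-trans N≤n (ℕ.≤-trans (m≤m*m n) (ℕ.≤-reflexive (sym (m^2≡m*m n))))))

lemma3p3 : (δ : ℝ) → 0ᴿ <ᴿ δ → δ <ᴿ ½ᴿ →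
    (g : ℕ → ℝ) → (∀ n₁ → 0ᴿ <ᴿ g n₁) → =ω[1] g → =o[√n] g →
    let k₁ : ℕ → ℝ
        k₁ n₁ = g n₁ *ᴿ √ n₁
        k₂ : ℕ → ℝ
        k₂ n₂ = g (n₂ ^ 2)
    in
    ((A : AlgorithmFamily) (T₁ : ℕ → ℕ) →
      A RunsInTime T₁ → T₁ =O[n^ 1ᴿ +ᴿ δ ] →
      A SucceedsAtMost½+o[1]On k₁) →
    (A : AlgorithmFamily) (T₂ : ℕ → ℕ) →
    A RunsInTime T₂ → T₂ =O[n^ fromℕ 2 +ᴿ fromℕ 2 *ᴿ δ ] →
    A SucceedsAtMost½+o[1]On k₂
lemma3p3 δ _ _ g _ _ _ hard A T₂ inTime T₂=O = succeeds-square A g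
  -- At `n` the new family has the running time and program length of `A` at ⌊√n⌋, so `T₂ ∘ isqrt`
  -- bounds both.
  (hard (squareRootFamily A) (T₂ ∘ isqrt) (inTime ∘ isqrt) (isqrt-time δ T₂ T₂=O))
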